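{- Let $A,B$ be bounded distributive lattices with canonical extensions $A^\delta,B^\delta$, and let $f,g:A^\delta\to B^\delta$ be monotone maps, each of which is both closed Esakia and open Esakia. 1. If $f(a)\in K(B^\delta)$ for all $a\in A$, and $f(a\vee b)\le f(a)\vee f(b)$ for all $a,b\in A$, then $f(u\vee v)\le f(u)\vee f(v)$ for all $u,v\in A^\delta$. 2. If $g(a)\in O(B^\delta)$ for all $a\in A$, and $g(a\wedge b)\ge g(a)\wedge g(b)$ for all $a,b\in A$, then $g(u\wedge v)\ge g(u)\wedge g(v)$ for all $u,v\in A^\delta$.
   Context: The canonical extension of a bounded distributive lattice $A$ is the (unique up to isomorphism) complete bounded distributive lattice $A^\delta$ containing $A$ as a sublattice such that (denseness) every element of $A^\delta$ is both a join of meets and a meet of joins of elements of $A$, and (compactness) for all $S,T\subseteq A$ with $\bigwedge S\le\bigvee T$ in $A^\delta$ there are finite $F\subseteq S$, $G\subseteq T$ with $\bigwedge F\le\bigvee G$. It is a perfect distributive lattice (complete, completely distributive, completely join-generated by its completely join-prime elements). $K(A^\delta)$ (closed elements) is the set of meets, $O(A^\delta)$ (open elements) the set of joins, of subsets of $A$; similarly for $B$. A map $h:A^\delta\to B^\delta$ is closed Esakia if $h(\bigwedge\{c_i:i\in I\})=\bigwedge\{h(c_i):i\in I\}$ for every downward-directed $\{c_i:i\in I\}\subseteq K(A^\delta)$, and open Esakia if $h(\bigvee\{o_i:i\in I\})=\bigvee\{h(o_i):i\in I\}$ for every upward-directed $\{o_i:i\in I\}\subseteq O(A^\delta)$ (directed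 families are nonempty). -}

module Defs where

open import Algebra.Lattice.Bundles.Raw using (RawLattice)
open import Algebra.Lattice.Morphism.Structures using (IsLatticeMonomorphism)
open import Data.List.Base using (List; foldr)
open import Data.List.Relation.Unary.All using (All)
open import Data.Product.Base using (Σ; Σ-syntax; ∃-syntax; _×_; proj₁)
open import Function.Base using (_∘_; flip)
open import Level using (Level; _⊔_; suc)
open import Relation.Binary.Core using (Rel; _Preserves_⟶_)
open import Relation.Binary.Lattice using (BoundedLattice)
open import Relation.Unary using (Pred)
import Algebra.Definitions as AlgebraDefinitions

module _ {c ℓ i : Level} {X : Set c} (_≤_ : Rel X ℓ) {I : Set i} (f : I → X) where

  IsSupOf : X → Set (c ⊔ ℓ ⊔ i)
  IsSupOf x = (∀ j → f j ≤ x) × (∀ y → (∀ j → f j ≤ y) → x ≤ y)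

  UpDirected : Set (ℓ ⊔ i)
  UpDirected = I × (∀ j k → ∃[ m ] (f j ≤ f m × f k ≤ f m))

module _ {c ℓ i : Level} {X : Set c} (_≤_ : Rel X ℓ) {I : Set i} (f : I → X) where

  IsInfOf : X → Set (c ⊔ ℓ ⊔ i)
  IsInfOf = IsSupOf (flip _≤_) f

  DownDirected : Set (ℓ ⊔ i)
  DownDirected = UpDirected (flip _≤_) f

record BoundedDistributiveLattice (c ℓ₁ ℓ₂ : Level) : Set (suc (c ⊔ ℓ₁ ⊔ ℓ₂)) where
  field
    boundedLattice : BoundedLattice c ℓ₁ ℓ₂

  open BoundedLattice boundedLattice public

  field
    ∧-distribˡ-∨ : AlgebraDefinitions._DistributesOverˡ_ _≈_ _∧_ _∨_

  rawLattice : RawLattice c ℓ₁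
  rawLattice = record { Carrier = Carrier ; _≈_ = _≈_ ; _∧_ = _∧_ ; _∨_ = _∨_ }

  ⋀ᶠ ⋁ᶠ : List Carrier → Carrier
  ⋀ᶠ = foldr _∧_ ⊤
  ⋁ᶠ = foldr _∨_ ⊥

record CompleteDistributiveLattice (c κ : Level) : Set (suc (c ⊔ κ)) where
  field
    boundedDistributiveLattice : BoundedDistributiveLattice c κ κ

  open BoundedDistributiveLattice boundedDistributiveLattice public

  field
    ⋁ ⋀     : {I : Set κ} → (I → Carrier) → Carrier
    ⋁-isSup : {I : Set κ} (f : I → Carrier) → IsSupOf _≤_ f (⋁ f)
    ⋀-isInf : {I : Set κ} (f : I → Carrier) → IsInfOf _≤_ f (⋀ f)

-- Subsets of A are predicates at the level ℓ of A, whereas the order of the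
-- extension and the index sets of its joins and meets live at ℓ ⊔ r.  Taking
-- everything at one level is the instance r = ℓ; a larger r leaves room for
-- predicative constructions, whose order quantifies over all filters of A.
record CanonicalExtension {ℓ : Level} (A : BoundedDistributiveLattice ℓ ℓ ℓ) (c r : Level)
                          : Set (suc (ℓ ⊔ c ⊔ r)) where
  private
    module A = BoundedDistributiveLattice A

  field
    completeDistributiveLattice : CompleteDistributiveLattice c (ℓ ⊔ r)

  open CompleteDistributiveLattice completeDistributiveLattice public

  field
    η                     : A.Carrier → Carrier
    isLatticeMonomorphism : IsLatticeMonomorphism A.rawLattice rawLattice η
    η-⊤                   : η A.⊤ ≈ ⊤
    η-⊥                   : η A.⊥ ≈ ⊥

  _IsMeetOf_ : Carrier → Pred A.Carrier ℓ → Set (ℓ ⊔ c ⊔ r)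
  x IsMeetOf S = IsInfOf _≤_ {I = Σ A.Carrier S} (η ∘ proj₁) x

  _IsJoinOf_ : Carrier → Pred A.Carrier ℓ → Set (ℓ ⊔ c ⊔ r)
  x IsJoinOf S = IsSupOf _≤_ {I = Σ A.Carrier S} (η ∘ proj₁) x

  Closed : Pred Carrier (suc ℓ ⊔ c ⊔ r)
  Closed x = ∃[ S ] x IsMeetOf S

  Open : Pred Carrier (suc ℓ ⊔ c ⊔ r)
  Open x = ∃[ S ] x IsJoinOf S

  field
    dense-⋁ : ∀ x → Σ[ I ∈ Set (ℓ ⊔ r) ] Σ[ k ∈ (I → Carrier) ]
                      ((∀ i → Closed (k i)) × IsSupOf _≤_ k x)
    dense-⋀ : ∀ x → Σ[ I ∈ Set (ℓ ⊔ r) ] Σ[ o ∈ (I → Carrier) ]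
                      ((∀ i → Open (o i)) × IsInfOf _≤_ o x)
    compact : ∀ (S T : Pred A.Carrier ℓ) {x y} → x IsMeetOf S → y IsJoinOf T → x ≤ y →
              ∃[ F ] ∃[ G ] (All S F × All T G × A.⋀ᶠ F A.≤ A.⋁ᶠ G)

module _ {ℓ c d r : Level} {A B : BoundedDistributiveLattice ℓ ℓ ℓ}
         (Aδ : CanonicalExtension A c r) (Bδ : CanonicalExtension B d r) where
  private
    module Aδ = CanonicalExtension Aδ
    module Bδ = CanonicalExtension Bδ

  Monotone : Pred (Aδ.Carrier → Bδ.Carrier) (ℓ ⊔ c ⊔ r)
  Monotone h = h Preserves Aδ._≤_ ⟶ Bδ._≤_

  ClosedEsakia : Pred (Aδ.Carrier → Bδ.Carrier) (suc ℓ ⊔ c ⊔ suc r)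
  ClosedEsakia h = {I : Set (ℓ ⊔ r)} (k : I → Aδ.Carrier) →
                   (∀ i → Aδ.Closed (k i)) → DownDirected Aδ._≤_ k →
                   h (Aδ.⋀ k) Bδ.≈ Bδ.⋀ (h ∘ k)

  OpenEsakia : Pred (Aδ.Carrier → Bδ.Carrier) (suc ℓ ⊔ c ⊔ suc r)
  OpenEsakia h = {I : Set (ℓ ⊔ r)} (o : I → Aδ.Carrier) →
                 (∀ i → Aδ.Open (o i)) → UpDirected Aδ._≤_ o →
                 h (Aδ.⋁ o) Bδ.≈ Bδ.⋁ (h ∘ o)

{-# OPTIONS --safe #-}

-- Fix an open o ≥ f u ∨ f v.  The set of a ∈ A with f a ≤ o is an ideal, by
-- monotonicity and subadditivity on A.  Every closed k ≤ u is the meet of a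
-- filter of A, so f k ≤ f u ≤ o together with compactness in Bδ yields a ≥ k
-- in that ideal; as u is a join of closed elements, u lies below the join of
-- the ideal, and so does v.  Since f preserves this directed join,
-- f (u ∨ v) ≤ o; now let o range over the open elements above f u ∨ f v, whose
-- meet is f u ∨ f v.  The second part is the first one for the order duals.

module Submission where

open import Defs
open import Algebra.Lattice.Morphism.Structures using (module IsLatticeMonomorphism)
open import Data.List.Base using (List; []; _∷_; _++_; [_])
open import Data.List.Relation.Unary.All as All using (All; []; _∷_)
import Data.List.Relation.Unary.All.Properties as All
open import Data.Product.Base using (Σ; ∃-syntax; _×_; _,_; proj₁; proj₂)
open import Function.Base using (_∘_; flip)
open import Level using (Level; Lift; lift; lower; _⊔_)
import Relation.Binary.Lattice.Properties.DistributiveLattice as DistributiveLatticeProperties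
import Relation.Binary.Lattice.Properties.Lattice as LatticeProperties
open import Relation.Binary.Core using (_Preserves_⟶_)
open import Relation.Unary using (Pred)

module BDLProperties {c ℓ₁ ℓ₂} (D : BoundedDistributiveLattice c ℓ₁ ℓ₂) where
  open BoundedDistributiveLattice D

  ⋀ᶠ-lower : ∀ F → All (⋀ᶠ F ≤_) F
  ⋀ᶠ-lower []      = []
  ⋀ᶠ-lower (a ∷ F) = x∧y≤x a (⋀ᶠ F) ∷ All.map (trans (x∧y≤y a (⋀ᶠ F))) (⋀ᶠ-lower F)

  ⋀ᶠ-greatest : ∀ {x F} → All (x ≤_) F → x ≤ ⋀ᶠ F
  ⋀ᶠ-greatest []       = maximum _
  ⋀ᶠ-greatest (p ∷ ps) = ∧-greatest p (⋀ᶠ-greatest ps)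

  ⋀ᶠ-++ˡ : ∀ F G → ⋀ᶠ (F ++ G) ≤ ⋀ᶠ F
  ⋀ᶠ-++ˡ F G = ⋀ᶠ-greatest (All.++⁻ˡ F (⋀ᶠ-lower (F ++ G)))

  ⋀ᶠ-++ʳ : ∀ F G → ⋀ᶠ (F ++ G) ≤ ⋀ᶠ G
  ⋀ᶠ-++ʳ F G = ⋀ᶠ-greatest (All.++⁻ʳ F (⋀ᶠ-lower (F ++ G)))

  dualBDL : BoundedDistributiveLattice c ℓ₁ ℓ₂
  dualBDL = record
    { boundedLattice = record
      { _≈_ = _≈_ ; _≤_ = flip _≤_ ; _∨_ = _∧_ ; _∧_ = _∨_ ; ⊤ = ⊥ ; ⊥ = ⊤
      ; isBoundedLattice = record
        { isLattice = LatticeProperties.∧-∨-isLattice lattice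
        ; maximum   = minimum
        ; minimum   = maximum
        }
      }
    ; ∧-distribˡ-∨ = DistributiveLatticeProperties.∨-distribˡ-∧ (record
        { isDistributiveLattice = record
          { isLattice = isLattice ; ∧-distribˡ-∨ = ∧-distribˡ-∨ } })
    }

open BDLProperties using (dualBDL)

module CanonicalExtensionProperties {ℓ c r} {A : BoundedDistributiveLattice ℓ ℓ ℓ}
                                    (Aδ : CanonicalExtension A c r) where
  private
    module A where
      open BoundedDistributiveLattice A public
      open BDLProperties A public

  open CanonicalExtension Aδ
  open IsLatticeMonomorphism isLatticeMonomorphism using (∧-homo; ∨-homo; ⟦⟧-cong; injective)

  η-monotone : η Preserves A._≤_ ⟶ _≤_
  η-monotone {a} {b} a≤b = trans (y≤x∨y (η b) (η a)) (reflexive (Eq.trans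
    (Eq.sym (∨-homo b a)) (⟦⟧-cong (A.antisym (A.∨-least A.refl a≤b) (A.x≤x∨y b a)))))

  ηa-open : ∀ a → Open (η a)
  ηa-open a = (A._≤ a) , (λ (_ , b≤a) → η-monotone b≤a) , λ _ ub → ub (a , A.refl)

  η⋁ᶠ≤join : ∀ {T y G} → y IsJoinOf T → All T G → η (A.⋁ᶠ G) ≤ y
  η⋁ᶠ≤join _            []       = trans (reflexive η-⊥) (minimum _)
  η⋁ᶠ≤join yT@(ub , _) (t ∷ ts) =
    trans (reflexive (∨-homo _ _)) (∨-least (ub (_ , t)) (η⋁ᶠ≤join yT ts))

  -- The index set has to be at the level ℓ for the union of subsets of A
  -- representing the k i to be a subset of A again.
  directed-compact : {I : Set ℓ} (k : I → Carrier) → (∀ i → Closed (k i)) →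
                     DownDirected _≤_ k → ∀ {x y} → IsInfOf _≤_ k x → Open y → x ≤ y →
                     ∃[ i ] k i ≤ y
  directed-compact {I} k k-closed (i₀ , directed) {x} {y} (x-lb , x-glb) (T , yT) x≤y =
    let F , G , F⊆U , G⊆T , F≤G = compact U T xU yT x≤y
        i , ki≤F                = below F⊆U
    in i , trans ki≤F (trans (η-monotone F≤G) (η⋁ᶠ≤join yT G⊆T))
    where
    U : Pred A.Carrier ℓ
    U a = ∃[ i ] proj₁ (k-closed i) a

    xU : x IsMeetOf U
    xU = (λ (a , i , a∈Sᵢ) → trans (x-lb i) (proj₁ (proj₂ (k-closed i)) (a , a∈Sᵢ)))
       , (λ z lb → x-glb z (λ i → proj₂ (proj₂ (k-closed i)) z
                                     (λ (a , a∈Sᵢ) → lb (a , i , a∈Sᵢ))))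

    -- Finitely many members of `U` involve finitely many indices, which directedness merges into
    -- one; `i₀` serves the empty list.
    below : ∀ {F} → All U F → ∃[ i ] k i ≤ η (A.⋀ᶠ F)
    below []                = i₀ , trans (maximum _) (reflexive (Eq.sym η-⊤))
    below ((i , a∈Sᵢ) ∷ us) =
      let j , kj≤F        = below us
          m , km≤ki , km≤kj = directed i j
      in m , trans (∧-greatest (trans km≤ki (proj₁ (proj₂ (k-closed i)) (_ , a∈Sᵢ)))
                               (trans km≤kj kj≤F))
                   (reflexive (Eq.sym (∧-homo _ _)))

  -- Finite meets turn an arbitrary `S` into a directed family with the same meet, the form that the
  -- closed Esakia condition and `directed-compact` require.
  module FilterBase (S : Pred A.Carrier ℓ) where

    Index : Set ℓ
    Index = Σ (List A.Carrier) (All S)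

    element : Index → A.Carrier
    element (F , _) = A.⋀ᶠ F

    directed : DownDirected _≤_ (η ∘ element)
    -- The empty list keeps the family nonempty even when `S` is empty.
    directed = ([] , []) , λ (F , F⊆S) (G , G⊆S) →
      (F ++ G , All.++⁺ F⊆S G⊆S) , η-monotone (A.⋀ᶠ-++ˡ F G) , η-monotone (A.⋀ᶠ-++ʳ F G)

    meet≤ : ∀ {x} → x IsMeetOf S → ∀ i → x ≤ η (element i)
    meet≤ xS          ([]    , [])     = trans (maximum _) (reflexive (Eq.sym η-⊤))
    meet≤ xS@(lb , _) (_ ∷ F , s ∷ ss) = trans
      (∧-greatest (lb (_ , s)) (meet≤ xS (F , ss))) (reflexive (Eq.sym (∧-homo _ _)))

    lowerBound≤meet : ∀ {x} → x IsMeetOf S → ∀ y → (∀ i → y ≤ η (element i)) → y ≤ x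
    lowerBound≤meet (_ , glb) y y≤ = glb y λ (a , a∈S) →
      trans (y≤ ([ a ] , a∈S ∷ [])) (η-monotone (A.x∧y≤x a A.⊤))

  -- The axioms are self-dual: reversing the order exchanges closed with open elements, and with
  -- them the two density axioms.
  dualExtension : CanonicalExtension (dualBDL A) c r
  dualExtension = record
    { completeDistributiveLattice = record
      { boundedDistributiveLattice = dualBDL boundedDistributiveLattice
      ; ⋁ = ⋀ ; ⋀ = ⋁ ; ⋁-isSup = ⋀-isInf ; ⋀-isInf = ⋁-isSup
      }
    ; η = η
    ; isLatticeMonomorphism = record
      { isLatticeHomomorphism = record
        { isRelHomomorphism = record { cong = ⟦⟧-cong }
        ; ∧-homo = ∨-homo
        ; ∨-homo = ∧-homo
        }
      ; injective = injective
      }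
    ; η-⊤ = η-⊥
    ; η-⊥ = η-⊤
    ; dense-⋁ = dense-⋀
    ; dense-⋀ = dense-⋁
    -- Joins of the dual are meets of the original, so `T` supplies the meet and `S` the join, and
    -- the two lists trade places.
    ; compact = λ S T xS yT y≤x →
        let F , G , F⊆T , G⊆S , F≤G = compact T S yT xS y≤x in G , F , G⊆S , F⊆T , F≤G
    }

open CanonicalExtensionProperties using (dualExtension)

module _ {ℓ c d r : Level} {A B : BoundedDistributiveLattice ℓ ℓ ℓ}
         (Aδ : CanonicalExtension A c r) (Bδ : CanonicalExtension B d r) where
  private
    module A  = BoundedDistributiveLattice A
    module Aδ where
      open CanonicalExtension Aδ public
      open CanonicalExtensionProperties Aδ public
    module Bδ where
      open CanonicalExtension Bδ public
      open CanonicalExtensionProperties Bδ public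

  module Subadditive
    (f : Aδ.Carrier → Bδ.Carrier)
    (f-monotone : Monotone Aδ Bδ f)
    (f-closedEsakia : ClosedEsakia Aδ Bδ f) (f-openEsakia : OpenEsakia Aδ Bδ f)
    (fη-closed : ∀ a → Bδ.Closed (f (Aδ.η a)))
    (fη-subadditive : ∀ a b → f (Aδ.η (a A.∨ b)) Bδ.≤ (f (Aδ.η a) Bδ.∨ f (Aδ.η b)))
    where

    -- Write `x` as a directed meet of elements of `A`. Closed Esakia carries it to a directed meet
    -- of closed elements lying below `o`, and compactness picks one of them.
    closed-interpolation : ∀ {x o} → Aδ.Closed x → Bδ.Open o → f x Bδ.≤ o →
                           ∃[ a ] (x Aδ.≤ Aδ.η a × f (Aδ.η a) Bδ.≤ o)
    closed-interpolation {x} {o} (S , xS) o-open fx≤o =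
      let i , fi≤o = Bδ.directed-compact (f ∘ k) (fη-closed ∘ element) fk-directed
                       fk-inf o-open f⋀k≤o
      in element i , meet≤ xS i , fi≤o
      where
      open Aδ.FilterBase S

      k : Index → Aδ.Carrier
      k = Aδ.η ∘ element

      -- The Esakia condition takes index sets at level `ℓ ⊔ r`, `directed-compact` those at level
      -- `ℓ`; lifting the indices bridges the two.
      k↑ : Lift (ℓ ⊔ r) Index → Aδ.Carrier
      k↑ = k ∘ lower

      k-closed : ∀ i → Aδ.Closed (k↑ i)
      k-closed i = (element (lower i) A.≤_)
                 , (λ (_ , a≤b) → Aδ.η-monotone a≤b) , λ _ lb → lb (_ , A.refl)

      k↑-directed : DownDirected Aδ._≤_ k↑
      k↑-directed = lift (proj₁ directed) , λ (lift i) (lift j) →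
        let m , p = proj₂ directed i j in lift m , p

      fk-directed : DownDirected Bδ._≤_ (f ∘ k)
      fk-directed = proj₁ directed , λ i j →
        let m , p , q = proj₂ directed i j in m , f-monotone p , f-monotone q

      fk-inf : IsInfOf Bδ._≤_ (f ∘ k) (Bδ.⋀ (f ∘ k↑))
      fk-inf = let lb , glb = Bδ.⋀-isInf (f ∘ k↑)
               in (λ i → lb (lift i)) , λ y y≤ → glb y (λ i → y≤ (lower i))

      f⋀k≤o : Bδ.⋀ (f ∘ k↑) Bδ.≤ o
      -- `⋀ k↑` is a lower bound of all finite meets from `S`, hence below `x`.
      f⋀k≤o = Bδ.trans (Bδ.reflexive (Bδ.Eq.sym (f-closedEsakia k↑ k-closed k↑-directed)))
        (Bδ.trans (f-monotone (lowerBound≤meet xS _ (λ i → proj₁ (Aδ.⋀-isInf k↑) (lift i))))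
                  fx≤o)

    module _ {o : Bδ.Carrier} (o-open : Bδ.Open o) where

      -- Membership is an inequality of `Bδ`, so it lives at level `ℓ ⊔ r`; the ideal is therefore
      -- an index type for joins instead of a `Pred` on `A` at level `ℓ`.
      Ideal : Set (ℓ ⊔ r)
      Ideal = ∃[ a ] f (Aδ.η a) Bδ.≤ o

      ι : Ideal → Aδ.Carrier
      ι = Aδ.η ∘ proj₁

      f≤o⇒≤⋁ideal : ∀ {u} → f u Bδ.≤ o → u Aδ.≤ Aδ.⋁ ι
      f≤o⇒≤⋁ideal {u} fu≤o =
        let I , k , k-closed , k≤u , k-lub = Aδ.dense-⋁ u
        in k-lub _ λ i →
             let a , ki≤a , fa≤o = closed-interpolation (k-closed i) o-open
                                     (Bδ.trans (f-monotone (k≤u i)) fu≤o)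
             in Aδ.trans ki≤a (proj₁ (Aδ.⋁-isSup ι) (a , fa≤o))

      ∨-preserves-f≤o : ∀ {u v} → f u Bδ.≤ o → f v Bδ.≤ o → f (u Aδ.∨ v) Bδ.≤ o
      ∨-preserves-f≤o {u} {v} fu≤o fv≤o =
        Bδ.trans (f-monotone (Aδ.∨-least (f≤o⇒≤⋁ideal fu≤o) (f≤o⇒≤⋁ideal fv≤o)))
        (Bδ.trans (Bδ.reflexive (f-openEsakia ι (Aδ.ηa-open ∘ proj₁) (⊥∈Ideal , ι-directed)))
        (proj₂ (Bδ.⋁-isSup (f ∘ ι)) o proj₂))
        where
        -- Open Esakia needs a nonempty family; `⊥` belongs to the ideal because
        -- `f (η ⊥) ≤ f u ≤ o`.
        ⊥∈Ideal : Ideal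
        ⊥∈Ideal = A.⊥ , Bδ.trans
          (f-monotone (Aδ.trans (Aδ.reflexive Aδ.η-⊥) (Aδ.minimum u))) fu≤o

        -- Subadditivity on `A` enters here: it closes the ideal under binary joins.
        ι-directed : ∀ i j → ∃[ m ] (ι i Aδ.≤ ι m × ι j Aδ.≤ ι m)
        ι-directed (a , fa≤o) (b , fb≤o) =
          (a A.∨ b , Bδ.trans (fη-subadditive a b) (Bδ.∨-least fa≤o fb≤o))
          , Aδ.η-monotone (A.x≤x∨y a b) , Aδ.η-monotone (A.y≤x∨y a b)

    subadditive : ∀ u v → f (u Aδ.∨ v) Bδ.≤ (f u Bδ.∨ f v)
    subadditive u v =
      let J , o , o-open , fu∨fv≤o , o-glb = Bδ.dense-⋀ (f u Bδ.∨ f v)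
      in o-glb _ λ j → ∨-preserves-f≤o (o-open j)
           (Bδ.trans (Bδ.x≤x∨y _ _) (fu∨fv≤o j)) (Bδ.trans (Bδ.y≤x∨y _ _) (fu∨fv≤o j))

theorem23 :
    {ℓ c d r : Level} (A B : BoundedDistributiveLattice ℓ ℓ ℓ)
    (Aδ : CanonicalExtension A c r) (Bδ : CanonicalExtension B d r) →
    let module A  = BoundedDistributiveLattice A
        module Aδ = CanonicalExtension Aδ
        module Bδ = CanonicalExtension Bδ
    in
    (f g : Aδ.Carrier → Bδ.Carrier) →
    Monotone Aδ Bδ f → ClosedEsakia Aδ Bδ f → OpenEsakia Aδ Bδ f →
    Monotone Aδ Bδ g → ClosedEsakia Aδ Bδ g → OpenEsakia Aδ Bδ g →
    ( (∀ a → Bδ.Closed (f (Aδ.η a))) →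
      (∀ a b → f (Aδ.η (a A.∨ b)) Bδ.≤ (f (Aδ.η a) Bδ.∨ f (Aδ.η b))) →
      ∀ u v → f (u Aδ.∨ v) Bδ.≤ (f u Bδ.∨ f v) )
    ×
    ( (∀ a → Bδ.Open (g (Aδ.η a))) →
      (∀ a b → (g (Aδ.η a) Bδ.∧ g (Aδ.η b)) Bδ.≤ g (Aδ.η (a A.∧ b))) →
      ∀ u v → (g u Bδ.∧ g v) Bδ.≤ g (u Aδ.∧ v) )
theorem23 A B Aδ Bδ f g f-mono f-closed f-open g-mono g-closed g-open =
    Subadditive.subadditive Aδ Bδ f f-mono f-closed f-open
  -- Between the duals, open Esakia reads as closed Esakia and conversely, so `g-open` and
  -- `g-closed` change places.
  , Subadditive.subadditive (dualExtension Aδ) (dualExtension Bδ) g g-mono g-open g-closed
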